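{- Let $K$ be a field of characteristic $0$. Let $n_1>n_2>n_3$ be positive integers with $n_1+n_3>2n_2$, and let $a_1,a_2,a_3,a_4\in K$ with $a_1a_2a_3\neq 0$. Put $f(x)=a_1x^{n_1}+a_2x^{n_2}+a_3x^{n_3}+a_4$. Suppose $f(x)=g(h(x))$ with $g,h\in K[x]$, $\deg g\geq 2$, $\deg h\geq 2$, $h$ monic and $h(0)=0$. Then $h(x)=x^k$ and $g(x)=a_1x^{n_1/k}+a_2x^{n_2/k}+a_3x^{n_3/k}+a_4$ for some positive integer $k$ dividing $\gcd(n_1,n_2,n_3)$. -}

module Defs where

open import Level using (_⊔_)
open import Algebra.Bundles using (CommutativeRing)
open import Data.Nat using (ℕ; zero; suc; _≤_; _<_)
open import Data.List using (List; []; _∷_; replicate; _++_)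
open import Data.Product using (Σ; _×_; ∃)
open import Relation.Nullary using (¬_)

module PolyDefs {c ℓ} (R : CommutativeRing c ℓ) where
  open CommutativeRing R

  IsField : Set (c ⊔ ℓ)
  IsField = (1# ≉ 0#) × (∀ x → x ≉ 0# → Σ Carrier λ y → (x * y) ≈ 1#)

  ofℕ : ℕ → Carrier
  ofℕ zero = 0#
  ofℕ (suc n) = 1# + ofℕ n

  CharZero : Set ℓ
  CharZero = ∀ n → ofℕ (suc n) ≉ 0#

  -- polynomials as coefficient lists, lowest degree first
  Poly : Set c
  Poly = List Carrier

  coeff : Poly → ℕ → Carrier
  coeff [] _ = 0#
  coeff (a ∷ p) zero = a
  coeff (a ∷ p) (suc i) = coeff p i

  -- equality of polynomials: all coefficients equal (trailing zeros irrelevant)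
  _≈ₚ_ : Poly → Poly → Set ℓ
  p ≈ₚ q = ∀ i → coeff p i ≈ coeff q i

  _+ₚ_ : Poly → Poly → Poly
  [] +ₚ q = q
  (a ∷ p) +ₚ [] = a ∷ p
  (a ∷ p) +ₚ (b ∷ q) = (a + b) ∷ (p +ₚ q)

  scale : Carrier → Poly → Poly
  scale a [] = []
  scale a (b ∷ p) = (a * b) ∷ scale a p

  _*ₚ_ : Poly → Poly → Poly
  [] *ₚ q = []
  (a ∷ p) *ₚ q = scale a q +ₚ (0# ∷ (p *ₚ q))

  -- composition g ∘ h, i.e. g(h(x)), by Horner's scheme
  _∘ₚ_ : Poly → Poly → Poly
  [] ∘ₚ h = []
  (a ∷ g) ∘ₚ h = (a ∷ []) +ₚ (h *ₚ (g ∘ₚ h))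

  mono : Carrier → ℕ → Poly
  mono a n = replicate n 0# ++ (a ∷ [])

  HasDegree : Poly → ℕ → Set ℓ
  HasDegree p d = (coeff p d ≉ 0#) × (∀ i → d < i → coeff p i ≈ 0#)

  DegreeAtLeast : Poly → ℕ → Set ℓ
  DegreeAtLeast p m = ∃ λ d → m ≤ d × HasDegree p d

  Monic : Poly → Set ℓ
  Monic p = ∃ λ d → HasDegree p d × (coeff p d ≈ 1#)

{-# OPTIONS --safe #-}

-- Write d = deg h and m = deg g, so that n₁ = m d.  If h has no exponents strictly
-- between r and d, then the coefficient of x^((m-1)d + r) in g(h(x)) is m g_m h_r.
-- Hence if n₂ ≤ (m-1)d, all middle coefficients of h vanish and h = x^d.
-- Otherwise n₂ = (m-1)d + r with 0 < r < d, and the same formula gives h_r ≠ 0.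
-- Then h vanishes at 0 to some order t ≤ r, and g - g(0) to some order s ≤ m, so x^(st)
-- occurs in f with 0 < st ≤ m r ≤ 2n₂ - n₁ < n₃, which is absurd.
module Submission where

open import Defs
open import Algebra.Bundles using (CommutativeRing)
open import Level using (Level)
open import Data.Nat using (ℕ; zero; suc; _<_; _≤_; z≤n; s≤s; _/_; NonZero; >-nonZero)
import Data.Nat as N
import Data.Nat.Properties as NP
open import Data.Nat.Divisibility using (_∣_; _∣?_; ∣m∣n⇒∣m+n; ∣-refl; _∣0)
open import Data.Nat.DivMod using (m/n*n≡m)
open import Data.Nat.GCD using (gcd; gcd-greatest)
import Data.Nat.Solver as NS
open import Data.Empty using (⊥)
open import Data.List using ([]; _∷_)
open import Data.Product using (Σ; _×_; _,_; proj₁; proj₂)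
open import Relation.Binary.Definitions using (tri<; tri≈; tri>)
open import Relation.Binary.PropositionalEquality as ≡ using (_≡_; _≢_)
open import Relation.Nullary using (¬_; yes; no; contradiction)

module Coefficients {c ℓ : Level} (R : CommutativeRing c ℓ) where
  open CommutativeRing R hiding (zero)
  open PolyDefs R
  open import Relation.Binary.Reasoning.Setoid setoid

  -- Coefficients of sums, monomials and products.

  DegreeAtMost : Poly → ℕ → Set ℓ
  DegreeAtMost p d = ∀ i → d < i → coeff p i ≈ 0#

  coeff-≡ : ∀ p {i j} → i ≡ j → coeff p i ≈ coeff p j
  coeff-≡ p ≡.refl = refl

  coeff-+ₚ : ∀ p q i → coeff (p +ₚ q) i ≈ coeff p i + coeff q i
  coeff-+ₚ [] q i = sym (+-identityˡ _)
  coeff-+ₚ (a ∷ p) [] i = sym (+-identityʳ _)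
  coeff-+ₚ (a ∷ p) (b ∷ q) zero = refl
  coeff-+ₚ (a ∷ p) (b ∷ q) (suc i) = coeff-+ₚ p q i

  coeff-scale : ∀ a p i → coeff (scale a p) i ≈ a * coeff p i
  coeff-scale a [] i = sym (zeroʳ a)
  coeff-scale a (b ∷ p) zero = refl
  coeff-scale a (b ∷ p) (suc i) = coeff-scale a p i

  coeff-mono-≡ : ∀ a n → coeff (mono a n) n ≈ a
  coeff-mono-≡ a zero = refl
  coeff-mono-≡ a (suc n) = coeff-mono-≡ a n

  coeff-mono-≢ : ∀ a n i → i ≢ n → coeff (mono a n) i ≈ 0#
  coeff-mono-≢ a zero zero i≢n = contradiction ≡.refl i≢n
  coeff-mono-≢ a zero (suc i) i≢n = refl
  coeff-mono-≢ a (suc n) zero i≢n = refl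
  coeff-mono-≢ a (suc n) (suc i) i≢n = coeff-mono-≢ a n i λ e → i≢n (≡.cong suc e)

  coeff-mono-*d : ∀ a q i d → .{{_ : NonZero d}} → coeff (mono a q) i ≈ coeff (mono a (q N.* d)) (i N.* d)
  coeff-mono-*d a q i d with i N.≟ q
  ... | yes ≡.refl = trans (coeff-mono-≡ a q) (sym (coeff-mono-≡ a (q N.* d)))
  ... | no i≢q = trans (coeff-mono-≢ a q i i≢q)
                   (sym (coeff-mono-≢ a (q N.* d) (i N.* d) λ e → i≢q (NP.*-cancelʳ-≡ i q d e)))

  coeff-*-0 : ∀ a p q → coeff ((a ∷ p) *ₚ q) 0 ≈ a * coeff q 0
  coeff-*-0 a p q = begin
    coeff (scale a q +ₚ (0# ∷ (p *ₚ q))) 0 ≈⟨ coeff-+ₚ (scale a q) _ 0 ⟩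
    coeff (scale a q) 0 + 0#               ≈⟨ +-identityʳ _ ⟩
    coeff (scale a q) 0                    ≈⟨ coeff-scale a q 0 ⟩
    a * coeff q 0                          ∎

  coeff-*-suc : ∀ a p q n → coeff ((a ∷ p) *ₚ q) (suc n) ≈ a * coeff q (suc n) + coeff (p *ₚ q) n
  coeff-*-suc a p q n = trans (coeff-+ₚ (scale a q) _ (suc n)) (+-congʳ (coeff-scale a q (suc n)))

  -- A coefficient of a product is a convolution sum. This lemma and the next two evaluate it when
  -- no summand, at most one, or at most two can be nonzero, by recursion on `p` and without
  -- introducing finite sums.
  coeff-*-none : ∀ p q n → (∀ i k → i N.+ k ≡ n → coeff p i * coeff q k ≈ 0#) →
                 coeff (p *ₚ q) n ≈ 0#
  coeff-*-none [] q n z = refl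
  coeff-*-none (a ∷ p) q zero z = trans (coeff-*-0 a p q) (z 0 0 ≡.refl)
  coeff-*-none (a ∷ p) q (suc n) z = begin
    coeff ((a ∷ p) *ₚ q) (suc n)             ≈⟨ coeff-*-suc a p q n ⟩
    a * coeff q (suc n) + coeff (p *ₚ q) n   ≈⟨ +-cong (z 0 (suc n) ≡.refl)
                                                  (coeff-*-none p q n λ i k e → z (suc i) k (≡.cong suc e)) ⟩
    0# + 0#                                  ≈⟨ +-identityˡ 0# ⟩
    0#                                       ∎

  coeff-*-one : ∀ p q u v → (∀ i k → i N.+ k ≡ u N.+ v → i ≢ u → coeff p i * coeff q k ≈ 0#) →
                coeff (p *ₚ q) (u N.+ v) ≈ coeff p u * coeff q v
  coeff-*-one [] q u v z = sym (zeroˡ _)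
  coeff-*-one (a ∷ p) q zero zero z = coeff-*-0 a p q
  coeff-*-one (a ∷ p) q zero (suc v) z = begin
    coeff ((a ∷ p) *ₚ q) (suc v)             ≈⟨ coeff-*-suc a p q v ⟩
    a * coeff q (suc v) + coeff (p *ₚ q) v   ≈⟨ +-congˡ (coeff-*-none p q v λ i k e → z (suc i) k (≡.cong suc e) λ ()) ⟩
    a * coeff q (suc v) + 0#                 ≈⟨ +-identityʳ _ ⟩
    a * coeff q (suc v)                      ∎
  coeff-*-one (a ∷ p) q (suc u) v z = begin
    coeff ((a ∷ p) *ₚ q) (suc (u N.+ v))                     ≈⟨ coeff-*-suc a p q (u N.+ v) ⟩
    a * coeff q (suc (u N.+ v)) + coeff (p *ₚ q) (u N.+ v)   ≈⟨ +-cong (z 0 _ ≡.refl λ ())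
        (coeff-*-one p q u v λ i k e i≢u → z (suc i) k (≡.cong suc e) λ e′ → i≢u (NP.suc-injective e′)) ⟩
    0# + coeff p u * coeff q v                               ≈⟨ +-identityˡ _ ⟩
    coeff p u * coeff q v                                    ∎

  coeff-*-two : ∀ p q n u v u′ v′ → u N.+ v ≡ n → u′ N.+ v′ ≡ n → u < u′ →
                (∀ i k → i N.+ k ≡ n → i ≢ u → i ≢ u′ → coeff p i * coeff q k ≈ 0#) →
                coeff (p *ₚ q) n ≈ coeff p u * coeff q v + coeff p u′ * coeff q v′
  coeff-*-two [] q n u v u′ v′ _ _ _ z = sym (trans (+-cong (zeroˡ _) (zeroˡ _)) (+-identityˡ 0#))
  -- Once the recursion reaches the smaller index `u`, only `u′` can contribute to the rest;
  -- `u < u′` fixes the order in which the two are met.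
  coeff-*-two (a ∷ p) q _ zero v (suc u′) v′ ≡.refl ≡.refl _ z =
    trans (coeff-*-suc a p q (u′ N.+ v′))
      (+-congˡ (coeff-*-one p q u′ v′ λ i k e i≢u′ →
        z (suc i) k (≡.cong suc e) (λ ()) λ e′ → i≢u′ (NP.suc-injective e′)))
  coeff-*-two (a ∷ p) q (suc n) (suc u) v (suc u′) v′ e₁ e₂ (s≤s u<u′) z = begin
    coeff ((a ∷ p) *ₚ q) (suc n)                              ≈⟨ coeff-*-suc a p q n ⟩
    a * coeff q (suc n) + coeff (p *ₚ q) n                    ≈⟨ +-cong (z 0 _ ≡.refl (λ ()) λ ())
        (coeff-*-two p q n u v u′ v′ (NP.suc-injective e₁) (NP.suc-injective e₂) u<u′ λ i k e i≢u i≢u′ →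
          z (suc i) k (≡.cong suc e) (λ e′ → i≢u (NP.suc-injective e′)) λ e′ → i≢u′ (NP.suc-injective e′)) ⟩
    0# + (coeff p u * coeff q v + coeff p u′ * coeff q v′)    ≈⟨ +-identityˡ _ ⟩
    coeff p u * coeff q v + coeff p u′ * coeff q v′           ∎

  -- Degree bounds and leading coefficients of products.

  *-zero-left : ∀ {x y} → x ≈ 0# → x * y ≈ 0#
  *-zero-left x≈0 = trans (*-congʳ x≈0) (zeroˡ _)

  *-zero-right : ∀ {x y} → y ≈ 0# → x * y ≈ 0#
  *-zero-right y≈0 = trans (*-congˡ y≈0) (zeroʳ _)

  <-of-sum : ∀ {i k u v} → i N.+ k ≡ u N.+ v → i < u → v < k
  <-of-sum {i} {k} {u} {v} e i<u = NP.≰⇒> λ k≤v → NP.<-irrefl e (NP.+-mono-<-≤ i<u k≤v)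

  *-degreeAtMost : ∀ p q d e → DegreeAtMost p d → DegreeAtMost q e → DegreeAtMost (p *ₚ q) (d N.+ e)
  *-degreeAtMost p q d e dp dq n lt = coeff-*-none p q n term
    where
    term : ∀ i k → i N.+ k ≡ n → coeff p i * coeff q k ≈ 0#
    term i k ≡.refl with d N.<? i
    ... | yes d<i = *-zero-left (dp i d<i)
    ... | no d≮i = *-zero-right (dq k (NP.≰⇒> λ k≤e → NP.<⇒≱ lt (NP.+-mono-≤ (NP.≮⇒≥ d≮i) k≤e)))

  *-leading : ∀ p q d e → DegreeAtMost p d → DegreeAtMost q e →
              coeff (p *ₚ q) (d N.+ e) ≈ coeff p d * coeff q e
  *-leading p q d e dp dq = coeff-*-one p q d e term
    where
    term : ∀ i k → i N.+ k ≡ d N.+ e → i ≢ d → coeff p i * coeff q k ≈ 0#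
    term i k eq i≢d with NP.<-cmp i d
    ... | tri< i<d _ _ = *-zero-right (dq k (<-of-sum eq i<d))
    ... | tri≈ _ i≡d _ = contradiction i≡d i≢d
    ... | tri> _ _ d<i = *-zero-left (dp i d<i)

  -- Top coefficients of a composition with h(0) = 0.

  coeff-∘-suc : ∀ a g h n → coeff ((a ∷ g) ∘ₚ h) (suc n) ≈ coeff (h *ₚ (g ∘ₚ h)) (suc n)
  coeff-∘-suc a g h n = trans (coeff-+ₚ (a ∷ []) (h *ₚ (g ∘ₚ h)) (suc n)) (+-identityˡ _)

  coeff-∘-pos : ∀ a g h n → 0 < n → coeff ((a ∷ g) ∘ₚ h) n ≈ coeff (h *ₚ (g ∘ₚ h)) n
  coeff-∘-pos a g h (suc n) _ = coeff-∘-suc a g h n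

  coeff-*-0-vanish : ∀ h p → coeff h 0 ≈ 0# → coeff (h *ₚ p) 0 ≈ 0#
  coeff-*-0-vanish [] p _ = refl
  coeff-*-0-vanish (b ∷ h) p z = trans (coeff-*-0 b h p) (*-zero-left z)

  coeff-∘-0 : ∀ g h → coeff h 0 ≈ 0# → coeff (g ∘ₚ h) 0 ≈ coeff g 0
  coeff-∘-0 [] h z = refl
  coeff-∘-0 (a ∷ g) h z = begin
    coeff ((a ∷ g) ∘ₚ h) 0                ≈⟨ coeff-+ₚ (a ∷ []) (h *ₚ (g ∘ₚ h)) 0 ⟩
    a + coeff (h *ₚ (g ∘ₚ h)) 0           ≈⟨ +-congˡ (coeff-*-0-vanish h (g ∘ₚ h) z) ⟩
    a + 0#                                ≈⟨ +-identityʳ a ⟩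
    a                                     ∎

  ∘-degreeAtMost : ∀ g h m d → 0 < d → coeff h 0 ≈ 0# → DegreeAtMost g m → DegreeAtMost h d →
                   DegreeAtMost (g ∘ₚ h) (m N.* d)
  ∘-degreeAtMost [] h m d 0<d h0 dg dh n lt = refl
  -- A bound of 0 does not make the tail `g` empty: it may still be a list of zeros, so the
  -- recursion continues with the bound 0.
  ∘-degreeAtMost (a ∷ g) h zero d 0<d h0 dg dh n lt =
    trans (coeff-∘-pos a g h n lt) (coeff-*-none h (g ∘ₚ h) n λ i k _ → *-zero-right (g∘h≈0 k))
    where
    g∘h≈0 : ∀ k → coeff (g ∘ₚ h) k ≈ 0#
    g∘h≈0 zero = trans (coeff-∘-0 g h h0) (dg 1 (s≤s z≤n))
    g∘h≈0 (suc k) = ∘-degreeAtMost g h zero d 0<d h0 (λ i _ → dg (suc i) (s≤s z≤n)) dh (suc k) (s≤s z≤n)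
  ∘-degreeAtMost (a ∷ g) h (suc m) d 0<d h0 dg dh n lt =
    trans (coeff-∘-pos a g h n (NP.≤-<-trans z≤n lt))
      (*-degreeAtMost h (g ∘ₚ h) d (m N.* d) dh
        (∘-degreeAtMost g h m d 0<d h0 (λ i m<i → dg (suc i) (s≤s m<i)) dh) n lt)

  ∘-leading : ∀ g h m d → 0 < d → coeff h 0 ≈ 0# → DegreeAtMost g m → DegreeAtMost h d → coeff h d ≈ 1# →
              coeff (g ∘ₚ h) (m N.* d) ≈ coeff g m
  ∘-leading [] h m d 0<d h0 dg dh hd = refl
  ∘-leading (a ∷ g) h zero d 0<d h0 dg dh hd = coeff-∘-0 (a ∷ g) h h0
  ∘-leading (a ∷ g) h (suc m) d 0<d h0 dg dh hd = begin
    coeff ((a ∷ g) ∘ₚ h) (d N.+ m N.* d)    ≈⟨ coeff-∘-pos a g h _ (NP.≤-trans 0<d (NP.m≤m+n d _)) ⟩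
    coeff (h *ₚ (g ∘ₚ h)) (d N.+ m N.* d)   ≈⟨ *-leading h (g ∘ₚ h) d (m N.* d) dh (∘-degreeAtMost g h m d 0<d h0 dg′ dh) ⟩
    coeff h d * coeff (g ∘ₚ h) (m N.* d)    ≈⟨ *-cong hd (∘-leading g h m d 0<d h0 dg′ dh hd) ⟩
    1# * coeff g m                          ≈⟨ *-identityˡ _ ⟩
    coeff g m                               ∎
    where
    dg′ : DegreeAtMost g m
    dg′ i m<i = dg (suc i) (s≤s m<i)

  -- Only the top power of h reaches this exponent, since h^m has degree at most m d. In h^(m+1) the
  -- gap forces all factors but one to contribute x^d and the remaining one h_r x^r, which can
  -- happen in m + 1 ways. Each Horner step of the induction adds one such way.
  ∘-second-coeff : ∀ g h m d r → 0 < r → r < d → coeff h 0 ≈ 0# →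
                   DegreeAtMost g (suc m) → DegreeAtMost h d → coeff h d ≈ 1# →
                   (∀ i → r < i → i < d → coeff h i ≈ 0#) →
                   coeff (g ∘ₚ h) (m N.* d N.+ r) ≈ ofℕ (suc m) * (coeff g (suc m) * coeff h r)
  ∘-second-coeff [] h m d r 0<r r<d h0 dg dh hd gap = sym (*-zero-right (zeroˡ _))
  -- The tail `g` has degree at most 0, so `g ∘ₚ h` is constant and only its coefficient at 0 can be
  -- paired with `coeff h r`.
  ∘-second-coeff (a ∷ g) h zero d r 0<r r<d h0 dg dh hd gap = begin
    coeff ((a ∷ g) ∘ₚ h) r           ≈⟨ coeff-∘-pos a g h r 0<r ⟩
    coeff (h *ₚ (g ∘ₚ h)) r          ≈⟨ coeff-≡ (h *ₚ (g ∘ₚ h)) (≡.sym (NP.+-identityʳ r)) ⟩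
    coeff (h *ₚ (g ∘ₚ h)) (r N.+ 0)  ≈⟨ coeff-*-one h (g ∘ₚ h) r 0 term ⟩
    coeff h r * coeff (g ∘ₚ h) 0     ≈⟨ *-congˡ (coeff-∘-0 g h h0) ⟩
    coeff h r * coeff g 0            ≈⟨ *-comm _ _ ⟩
    coeff g 0 * coeff h r            ≈⟨ *-identityˡ _ ⟨
    1# * (coeff g 0 * coeff h r)     ≈⟨ *-congʳ (+-identityʳ 1#) ⟨
    ofℕ 1 * (coeff g 0 * coeff h r)  ∎
    where
    term : ∀ i k → i N.+ k ≡ r N.+ 0 → i ≢ r → coeff h i * coeff (g ∘ₚ h) k ≈ 0#
    term i zero e i≢r = contradiction (NP.+-cancelʳ-≡ 0 i r e) i≢r
    term i (suc k) e i≢r = *-zero-right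
      (∘-degreeAtMost g h 0 d (NP.<-trans 0<r r<d) h0 (λ j 0<j → dg (suc j) (s≤s 0<j)) dh (suc k) (s≤s z≤n))
  ∘-second-coeff (a ∷ g) h (suc m) d r 0<r r<d h0 dg dh hd gap = begin
    coeff ((a ∷ g) ∘ₚ h) (suc m N.* d N.+ r)
      ≈⟨ coeff-∘-pos a g h _ (NP.≤-trans 0<r (NP.m≤n+m r _)) ⟩
    coeff (h *ₚ (g ∘ₚ h)) (suc m N.* d N.+ r)
      -- Two pairs survive: x^r from `h` against the leading term of `g ∘ₚ h`, and x^d against the
      -- exponent treated by induction. An index below `r` forces its partner above the degree of
      -- `g ∘ₚ h`; an index between `r` and `d` lies in the gap.
      ≈⟨ coeff-*-two h (g ∘ₚ h) _ r (suc m N.* d) d (m N.* d N.+ r)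
           (NP.+-comm r _) (≡.sym (NP.+-assoc d (m N.* d) r)) r<d term ⟩
    hr * coeff (g ∘ₚ h) (suc m N.* d) + coeff h d * coeff (g ∘ₚ h) (m N.* d N.+ r)
      ≈⟨ +-cong (*-congˡ (∘-leading g h (suc m) d 0<d h0 dg′ dh hd))
                (*-cong hd (∘-second-coeff g h m d r 0<r r<d h0 dg′ dh hd gap)) ⟩
    hr * gm + 1# * (ofℕ (suc m) * (gm * hr))
      ≈⟨ +-cong (*-comm hr gm) (*-identityˡ _) ⟩
    gm * hr + ofℕ (suc m) * (gm * hr)
      ≈⟨ +-congʳ (*-identityˡ _) ⟨
    1# * (gm * hr) + ofℕ (suc m) * (gm * hr)
      ≈⟨ distribʳ _ _ _ ⟨
    ofℕ (suc (suc m)) * (gm * hr) ∎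
    where
    0<d : 0 < d
    0<d = NP.<-trans 0<r r<d
    hr gm : Carrier
    hr = coeff h r
    gm = coeff g (suc m)
    dg′ : DegreeAtMost g (suc m)
    dg′ i m<i = dg (suc i) (s≤s m<i)
    term : ∀ i k → i N.+ k ≡ suc m N.* d N.+ r → i ≢ r → i ≢ d → coeff h i * coeff (g ∘ₚ h) k ≈ 0#
    term i k e i≢r i≢d with NP.<-cmp i r
    ... | tri< i<r _ _ = *-zero-right (∘-degreeAtMost g h (suc m) d 0<d h0 dg′ dh k
                           (<-of-sum (≡.trans e (NP.+-comm _ r)) i<r))
    ... | tri≈ _ i≡r _ = contradiction i≡r i≢r
    ... | tri> _ _ r<i with NP.<-cmp i d
    ...   | tri< i<d _ _ = *-zero-left (gap i r<i i<d)
    ...   | tri≈ _ i≡d _ = contradiction i≡d i≢d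
    ...   | tri> _ _ d<i = *-zero-left (dh i d<i)

  -- Composition with a power: here `h` is x^d.

  module _ (h : Poly) (d : ℕ) (0<d : 0 < d) (hd : coeff h d ≈ 1#) (h≢ : ∀ i → i ≢ d → coeff h i ≈ 0#) where

    *-power-shift : ∀ p n → coeff (h *ₚ p) (d N.+ n) ≈ coeff p n
    *-power-shift p n = trans
      (coeff-*-one h p d n λ i k _ i≢d → *-zero-left (h≢ i i≢d))
      (trans (*-congʳ hd) (*-identityˡ _))

    *-power-low : ∀ p n → n < d → coeff (h *ₚ p) n ≈ 0#
    *-power-low p n n<d = coeff-*-none h p n λ { i k ≡.refl →
      *-zero-left (h≢ i λ { ≡.refl → NP.<⇒≱ n<d (NP.m≤m+n i k) }) }

    ∘-power-multiple : ∀ g i → coeff (g ∘ₚ h) (i N.* d) ≈ coeff g i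
    ∘-power-multiple [] i = refl
    ∘-power-multiple (a ∷ g) zero = coeff-∘-0 (a ∷ g) h (h≢ 0 (NP.<⇒≢ 0<d))
    ∘-power-multiple (a ∷ g) (suc i) = begin
      coeff ((a ∷ g) ∘ₚ h) (d N.+ i N.* d)   ≈⟨ coeff-∘-pos a g h _ (NP.≤-trans 0<d (NP.m≤m+n d _)) ⟩
      coeff (h *ₚ (g ∘ₚ h)) (d N.+ i N.* d)  ≈⟨ *-power-shift (g ∘ₚ h) (i N.* d) ⟩
      coeff (g ∘ₚ h) (i N.* d)               ≈⟨ ∘-power-multiple g i ⟩
      coeff g i                              ∎

    -- Each Horner step subtracts `d` from the exponent, which keeps it a nonmultiple of `d`. It
    -- therefore never meets a constant term, and below `d` a multiple of x^d has no terms.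
    ∘-power-nonmultiple : ∀ g n → ¬ d ∣ n → coeff (g ∘ₚ h) n ≈ 0#
    ∘-power-nonmultiple [] n d∤n = refl
    ∘-power-nonmultiple (a ∷ g) zero d∤n = contradiction (d ∣0) d∤n
    ∘-power-nonmultiple (a ∷ g) (suc n) d∤n with d N.≤? suc n
    ... | no d≰n = trans (coeff-∘-suc a g h n) (*-power-low (g ∘ₚ h) (suc n) (NP.≰⇒> d≰n))
    ... | yes d≤n = begin
      coeff ((a ∷ g) ∘ₚ h) (suc n)                    ≈⟨ coeff-∘-suc a g h n ⟩
      coeff (h *ₚ (g ∘ₚ h)) (suc n)                   ≈⟨ coeff-≡ (h *ₚ (g ∘ₚ h)) (NP.m+[n∸m]≡n d≤n) ⟨
      coeff (h *ₚ (g ∘ₚ h)) (d N.+ (suc n N.∸ d))     ≈⟨ *-power-shift (g ∘ₚ h) (suc n N.∸ d) ⟩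
      coeff (g ∘ₚ h) (suc n N.∸ d)
        ≈⟨ ∘-power-nonmultiple g (suc n N.∸ d) (λ d∣ → d∤n (≡.subst (d ∣_) (NP.m+[n∸m]≡n d≤n) (∣m∣n⇒∣m+n ∣-refl d∣))) ⟩
      0#                                              ∎

  -- Orders of vanishing at 0.

  HasOrder : Poly → ℕ → Set ℓ
  HasOrder p n = (coeff p n ≉ 0#) × (∀ i → i < n → coeff p i ≈ 0#)

  -- Doubly negated, since ≈ need not be decidable.
  order-exists : ∀ p n → coeff p n ≉ 0# → ¬ ¬ (Σ ℕ λ t → t ≤ n × HasOrder p t)
  order-exists p n pn≉0 none = search n 0 (NP.+-identityʳ n) λ _ ()
    where
    search : ∀ j k → j N.+ k ≡ n → (∀ i → i < k → coeff p i ≈ 0#) → ⊥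
    search zero k ≡.refl z = none (k , NP.≤-refl , pn≉0 , z)
    search (suc j) k e z =
      none (k , ≡.subst (k ≤_) e (NP.m≤n+m k (suc j)) ,
        (λ pk≈0 → search j (suc k) (≡.trans (NP.+-suc j k) e) (extend pk≈0)) , z)
      where
      extend : coeff p k ≈ 0# → ∀ i → i < suc k → coeff p i ≈ 0#
      extend pk≈0 i i<1+k with i N.≟ k
      ... | yes ≡.refl = pk≈0
      ... | no i≢k = z i (NP.≤∧≢⇒< (NP.≤-pred i<1+k) i≢k)

  module _ (field′ : IsField) where

    *-cancel-≉0 : ∀ {x y} → x ≉ 0# → x * y ≈ 0# → y ≈ 0#
    *-cancel-≉0 {x} {y} x≉0 xy≈0 with proj₂ field′ x x≉0
    ... | x⁻¹ , xx⁻¹≈1 = begin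
      y               ≈⟨ *-identityˡ y ⟨
      1# * y          ≈⟨ *-congʳ (trans (*-comm x⁻¹ x) xx⁻¹≈1) ⟨
      (x⁻¹ * x) * y   ≈⟨ *-assoc x⁻¹ x y ⟩
      x⁻¹ * (x * y)   ≈⟨ *-zero-right xy≈0 ⟩
      0#              ∎

    *-order : ∀ p q s t → HasOrder p s → HasOrder q t → HasOrder (p *ₚ q) (s N.+ t)
    *-order p q s t (ps , p<) (qt , q<) = (λ z → qt (*-cancel-≉0 ps (trans (sym lowest) z))) , below
      where
      lowest : coeff (p *ₚ q) (s N.+ t) ≈ coeff p s * coeff q t
      lowest = coeff-*-one p q s t term
        where
        term : ∀ i k → i N.+ k ≡ s N.+ t → i ≢ s → coeff p i * coeff q k ≈ 0#
        term i k e i≢s with NP.<-cmp i s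
        ... | tri< i<s _ _ = *-zero-left (p< i i<s)
        ... | tri≈ _ i≡s _ = contradiction i≡s i≢s
        ... | tri> _ _ s<i = *-zero-right (q< k (<-of-sum (≡.sym e) s<i))
      below : ∀ n → n < s N.+ t → coeff (p *ₚ q) n ≈ 0#
      below n lt = coeff-*-none p q n term
        where
        term : ∀ i k → i N.+ k ≡ n → coeff p i * coeff q k ≈ 0#
        term i k ≡.refl with i N.<? s
        ... | yes i<s = *-zero-left (p< i i<s)
        ... | no i≮s = *-zero-right (q< k (NP.≰⇒> λ t≤k → NP.<⇒≱ lt (NP.+-mono-≤ (NP.≮⇒≥ i≮s) t≤k)))

    -- The lowest term of g(h) is that of g_s h^s, because `0 < t` gives every higher power of h a
    -- larger order.
    ∘-order : ∀ g h s t → 0 < t → HasOrder g s → HasOrder h t → HasOrder (g ∘ₚ h) (s N.* t)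
    ∘-order [] h s t 0<t (g≉0 , _) _ = contradiction refl g≉0
    ∘-order (a ∷ g) h zero t 0<t (a≉0 , _) (_ , h<) =
      (λ z → a≉0 (trans (sym (coeff-∘-0 (a ∷ g) h (h< 0 0<t))) z)) , λ _ ()
    ∘-order (a ∷ g) h (suc s) t 0<t (gs , g<) oh@(_ , h<) =
      (λ z → proj₁ o (trans (sym (coeff-∘-pos a g h _ (NP.≤-trans 0<t (NP.m≤m+n t _)))) z)) , below
      where
      o : HasOrder (h *ₚ (g ∘ₚ h)) (t N.+ s N.* t)
      o = *-order h (g ∘ₚ h) t (s N.* t) oh (∘-order g h s t 0<t (gs , λ i i<s → g< (suc i) (s≤s i<s)) oh)
      below : ∀ n → n < t N.+ s N.* t → coeff ((a ∷ g) ∘ₚ h) n ≈ 0#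
      below zero _ = trans (coeff-∘-0 (a ∷ g) h (h< 0 0<t)) (g< 0 (s≤s z≤n))
      below (suc n) lt = trans (coeff-∘-suc a g h n) (proj₂ o (suc n) lt)

    module _ (charZero : CharZero) where

      -- Downward induction on `i`: once the coefficients of `h` strictly between `i` and `d` are
      -- known to vanish, `∘-second-coeff` equates (m + 1) g_(m+1) h_i with a coefficient of g(h)
      -- that is zero by hypothesis.
      middle-coeffs-vanish : ∀ g h m d → coeff h 0 ≈ 0# → HasDegree g (suc m) → DegreeAtMost h d → coeff h d ≈ 1# →
        ∀ l → (∀ r → l < r → r < d → coeff (g ∘ₚ h) (m N.* d N.+ r) ≈ 0#) →
        ∀ i → l < i → i < d → coeff h i ≈ 0#
      middle-coeffs-vanish g h m d h0 (gm≉0 , dg) dh hd l z i = descend d i (NP.m≤n+m d i)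
        where
        -- `fuel` bounds d - i, so it drops as the recursive calls climb towards `d`.
        descend : ∀ fuel i → d ≤ i N.+ fuel → l < i → i < d → coeff h i ≈ 0#
        descend zero i d≤ _ i<d = contradiction (≡.subst (d ≤_) (NP.+-identityʳ i) d≤) (NP.<⇒≱ i<d)
        -- Characteristic 0 allows the factor m + 1 to be cancelled; the leading coefficient of `g`
        -- is cancelled after it.
        descend (suc fuel) i d≤ l<i i<d = *-cancel-≉0 gm≉0 (*-cancel-≉0 (charZero m) (trans (sym
          (∘-second-coeff g h m d i (NP.≤-<-trans z≤n l<i) i<d h0 dg dh hd λ j i<j j<d →
            descend fuel j (NP.≤-trans d≤ (≡.subst (N._≤ j N.+ fuel) (≡.sym (NP.+-suc i fuel)) (NP.+-monoˡ-≤ fuel i<j)))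
              (NP.<-trans l<i i<j) j<d))
          (z i l<i i<d)))

  -- Coefficients of the quadrinomial.

  quadrinomial : (a₁ a₂ a₃ a₄ : Carrier) (n₁ n₂ n₃ : ℕ) → Poly
  quadrinomial a₁ a₂ a₃ a₄ n₁ n₂ n₃ = (mono a₁ n₁ +ₚ mono a₂ n₂) +ₚ (mono a₃ n₃ +ₚ mono a₄ 0)

  coeff-quadrinomial : ∀ a₁ a₂ a₃ a₄ n₁ n₂ n₃ i →
    coeff (quadrinomial a₁ a₂ a₃ a₄ n₁ n₂ n₃) i ≈
    (coeff (mono a₁ n₁) i + coeff (mono a₂ n₂) i) + (coeff (mono a₃ n₃) i + coeff (mono a₄ 0) i)
  coeff-quadrinomial a₁ a₂ a₃ a₄ n₁ n₂ n₃ i = trans (coeff-+ₚ (mono a₁ n₁ +ₚ mono a₂ n₂) _ i)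
    (+-cong (coeff-+ₚ (mono a₁ n₁) _ i) (coeff-+ₚ (mono a₃ n₃) _ i))

  -- Replacing x by x^d multiplies every exponent by `d`, injectively since `d` is nonzero. This
  -- carries the coefficients of f at multiples of `d` back to `g`.
  coeff-quadrinomial-*d : ∀ a₁ a₂ a₃ a₄ q₁ q₂ q₃ i d → .{{_ : NonZero d}} →
    coeff (quadrinomial a₁ a₂ a₃ a₄ q₁ q₂ q₃) i ≈
    coeff (quadrinomial a₁ a₂ a₃ a₄ (q₁ N.* d) (q₂ N.* d) (q₃ N.* d)) (i N.* d)
  coeff-quadrinomial-*d a₁ a₂ a₃ a₄ q₁ q₂ q₃ i d = begin
    coeff (quadrinomial a₁ a₂ a₃ a₄ q₁ q₂ q₃) i
      ≈⟨ coeff-quadrinomial a₁ a₂ a₃ a₄ q₁ q₂ q₃ i ⟩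
    (coeff (mono a₁ q₁) i + coeff (mono a₂ q₂) i) + (coeff (mono a₃ q₃) i + coeff (mono a₄ 0) i)
      ≈⟨ +-cong (+-cong (coeff-mono-*d a₁ q₁ i d) (coeff-mono-*d a₂ q₂ i d))
                (+-cong (coeff-mono-*d a₃ q₃ i d) (coeff-mono-*d a₄ 0 i d)) ⟩
    _ ≈⟨ coeff-quadrinomial a₁ a₂ a₃ a₄ (q₁ N.* d) (q₂ N.* d) (q₃ N.* d) (i N.* d) ⟨
    coeff (quadrinomial a₁ a₂ a₃ a₄ (q₁ N.* d) (q₂ N.* d) (q₃ N.* d)) (i N.* d) ∎

  module _ (a₁ a₂ a₃ a₄ : Carrier) (n₁ n₂ n₃ : ℕ) where

    private
      f : Poly
      f = quadrinomial a₁ a₂ a₃ a₄ n₁ n₂ n₃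

    coeff-quadrinomial-other : ∀ i → i ≢ n₁ → i ≢ n₂ → i ≢ n₃ → i ≢ 0 → coeff f i ≈ 0#
    coeff-quadrinomial-other i ≢₁ ≢₂ ≢₃ ≢₄ = begin
      coeff f i
        ≈⟨ coeff-quadrinomial a₁ a₂ a₃ a₄ n₁ n₂ n₃ i ⟩
      _ ≈⟨ +-cong (+-cong (coeff-mono-≢ a₁ n₁ i ≢₁) (coeff-mono-≢ a₂ n₂ i ≢₂))
                  (+-cong (coeff-mono-≢ a₃ n₃ i ≢₃) (coeff-mono-≢ a₄ 0 i ≢₄)) ⟩
      (0# + 0#) + (0# + 0#)
        ≈⟨ trans (+-cong (+-identityˡ 0#) (+-identityˡ 0#)) (+-identityˡ 0#) ⟩
      0# ∎

    module _ (n₂<n₁ : n₂ < n₁) (n₃<n₂ : n₃ < n₂) (0<n₃ : 0 < n₃) where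

      coeff-quadrinomial-1 : coeff f n₁ ≈ a₁
      coeff-quadrinomial-1 = begin
        coeff f n₁
          ≈⟨ coeff-quadrinomial a₁ a₂ a₃ a₄ n₁ n₂ n₃ n₁ ⟩
        _ ≈⟨ +-cong (+-cong (coeff-mono-≡ a₁ n₁) (coeff-mono-≢ a₂ n₂ n₁ (NP.>⇒≢ n₂<n₁)))
                    (+-cong (coeff-mono-≢ a₃ n₃ n₁ (NP.>⇒≢ (NP.<-trans n₃<n₂ n₂<n₁)))
                            (coeff-mono-≢ a₄ 0 n₁ (NP.>⇒≢ (NP.≤-<-trans z≤n n₂<n₁)))) ⟩
        (a₁ + 0#) + (0# + 0#)
          ≈⟨ trans (+-cong (+-identityʳ a₁) (+-identityˡ 0#)) (+-identityʳ a₁) ⟩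
        a₁ ∎

      coeff-quadrinomial-2 : coeff f n₂ ≈ a₂
      coeff-quadrinomial-2 = begin
        coeff f n₂
          ≈⟨ coeff-quadrinomial a₁ a₂ a₃ a₄ n₁ n₂ n₃ n₂ ⟩
        _ ≈⟨ +-cong (+-cong (coeff-mono-≢ a₁ n₁ n₂ (NP.<⇒≢ n₂<n₁)) (coeff-mono-≡ a₂ n₂))
                    (+-cong (coeff-mono-≢ a₃ n₃ n₂ (NP.>⇒≢ n₃<n₂))
                            (coeff-mono-≢ a₄ 0 n₂ (NP.>⇒≢ (NP.≤-<-trans z≤n n₃<n₂)))) ⟩
        (0# + a₂) + (0# + 0#)
          ≈⟨ trans (+-cong (+-identityˡ a₂) (+-identityˡ 0#)) (+-identityʳ a₂) ⟩
        a₂ ∎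

      coeff-quadrinomial-3 : coeff f n₃ ≈ a₃
      coeff-quadrinomial-3 = begin
        coeff f n₃
          ≈⟨ coeff-quadrinomial a₁ a₂ a₃ a₄ n₁ n₂ n₃ n₃ ⟩
        _ ≈⟨ +-cong (+-cong (coeff-mono-≢ a₁ n₁ n₃ (NP.<⇒≢ (NP.<-trans n₃<n₂ n₂<n₁)))
                            (coeff-mono-≢ a₂ n₂ n₃ (NP.<⇒≢ n₃<n₂)))
                    (+-cong (coeff-mono-≡ a₃ n₃) (coeff-mono-≢ a₄ 0 n₃ (NP.>⇒≢ 0<n₃))) ⟩
        (0# + 0#) + (a₃ + 0#)
          ≈⟨ trans (+-cong (+-identityˡ 0#) (+-identityʳ a₃)) (+-identityˡ a₃) ⟩
        a₃ ∎

      coeff-quadrinomial-above : ∀ i → n₁ < i → coeff f i ≈ 0#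
      coeff-quadrinomial-above i n₁<i = coeff-quadrinomial-other i (NP.>⇒≢ n₁<i)
        (NP.>⇒≢ n₂<i) (NP.>⇒≢ (NP.<-trans n₃<n₂ n₂<i)) (NP.>⇒≢ (NP.≤-<-trans z≤n n₁<i))
        where
        n₂<i : n₂ < i
        n₂<i = NP.<-trans n₂<n₁ n₁<i

      coeff-quadrinomial-between : ∀ i → n₂ < i → i < n₁ → coeff f i ≈ 0#
      coeff-quadrinomial-between i n₂<i i<n₁ = coeff-quadrinomial-other i (NP.<⇒≢ i<n₁)
        (NP.>⇒≢ n₂<i) (NP.>⇒≢ (NP.<-trans n₃<n₂ n₂<i)) (NP.>⇒≢ (NP.≤-<-trans z≤n n₂<i))

      coeff-quadrinomial-below : ∀ i → 0 < i → i < n₃ → coeff f i ≈ 0#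
      coeff-quadrinomial-below i 0<i i<n₃ = coeff-quadrinomial-other i
        (NP.<⇒≢ (NP.<-trans i<n₂ n₂<n₁)) (NP.<⇒≢ i<n₂) (NP.<⇒≢ i<n₃) (NP.>⇒≢ 0<i)
        where
        i<n₂ : i < n₂
        i<n₂ = NP.<-trans i<n₃ n₃<n₂

-- Constraints on a decomposition of the quadrinomial.

module _ {c ℓ : Level} (R : CommutativeRing c ℓ) where
  open CommutativeRing R hiding (zero)
  open PolyDefs R
  open Coefficients R

  -- Either strict inequality places a nonzero leading coefficient, `coeff g m` or `a₁`, above the
  -- degree of the other side.
  ∘-quadrinomial-degree : ∀ n₁ n₂ n₃ → n₂ < n₁ → n₃ < n₂ → 0 < n₃ → ∀ a₁ a₂ a₃ a₄ → a₁ ≉ 0# → ∀ g h m d →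
    quadrinomial a₁ a₂ a₃ a₄ n₁ n₂ n₃ ≈ₚ (g ∘ₚ h) →
    0 < d → coeff h 0 ≈ 0# → HasDegree g m → DegreeAtMost h d → coeff h d ≈ 1# → n₁ ≡ m N.* d
  ∘-quadrinomial-degree n₁ n₂ n₃ lt₁ lt₂ lt₃ a₁ a₂ a₃ a₄ a₁≉0 g h m d f≈ 0<d h0 (gm≉0 , dg) dh hd
    with NP.<-cmp n₁ (m N.* d)
  ... | tri< n₁<md _ _ = contradiction
          (trans (sym (∘-leading g h m d 0<d h0 dg dh hd))
            (trans (sym (f≈ _)) (coeff-quadrinomial-above a₁ a₂ a₃ a₄ n₁ n₂ n₃ lt₁ lt₂ lt₃ _ n₁<md))) gm≉0
  ... | tri≈ _ e _ = e
  ... | tri> _ _ md<n₁ = contradiction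
          (trans (sym (coeff-quadrinomial-1 a₁ a₂ a₃ a₄ n₁ n₂ n₃ lt₁ lt₂ lt₃))
            (trans (f≈ n₁) (∘-degreeAtMost g h m d 0<d h0 dg dh n₁ md<n₁))) a₁≉0

  module _ (fld : IsField) (n₁ n₂ n₃ : ℕ) (lt₁ : n₂ < n₁) (lt₂ : n₃ < n₂) (lt₃ : 0 < n₃)
           (a₁ a₂ a₃ a₄ : Carrier) where

    -- Splitting the outer polynomial as `b ∷ g` turns its composition with `h`, minus `b`, into
    -- `h *ₚ (g ∘ₚ h)`. If the tail `g` has order s and `h` has order t, this product has order t +
    -- s t = (1 + s) t. That is positive because h(0) = 0, and at most (m + 1) r, while the
    -- quadrinomial has no term strictly between 0 and `n₃`.
    no-low-term : ∀ g h → quadrinomial a₁ a₂ a₃ a₄ n₁ n₂ n₃ ≈ₚ (g ∘ₚ h) → coeff h 0 ≈ 0# →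
                  ∀ m r → coeff g (suc m) ≉ 0# → coeff h r ≉ 0# → suc m N.* r < n₃ → ⊥
    no-low-term [] h f≈ h0 m r gm≉0 hr≉0 lt = gm≉0 refl
    no-low-term (b ∷ g) h f≈ h0 m r gm≉0 hr≉0 lt =
      -- The two orders exist only up to double negation, which is enough because the goal is `⊥`.
      order-exists h r hr≉0 λ { (t , t≤r , oh) →
      order-exists g m gm≉0 λ { (s , s≤m , og) → absurd t t≤r oh s s≤m og } }
      where
      absurd : ∀ t → t ≤ r → HasOrder h t → ∀ s → s ≤ m → HasOrder g s → ⊥
      absurd zero _ (h0≉0 , _) _ _ _ = h0≉0 h0
      absurd t@(suc _) t≤r oh s s≤m og =
        proj₁ (*-order fld h (g ∘ₚ h) t (s N.* t) oh (∘-order fld g h s t (s≤s z≤n) og oh))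
          (trans (sym (coeff-∘-pos b g h _ (s≤s z≤n))) (trans (sym (f≈ _))
            (coeff-quadrinomial-below a₁ a₂ a₃ a₄ n₁ n₂ n₃ lt₁ lt₂ lt₃ _ (s≤s z≤n)
              (NP.≤-<-trans (NP.*-mono-≤ (s≤s s≤m) t≤r) lt))))

-- For n₁ = (m + 2) d and n₂ = (m + 1) d + r one has 2 n₂ - n₁ = m d + 2 r, and r ≤ d makes this at
-- least (m + 2) r. Adding n₁ to both sides avoids truncated subtraction.
low-exponent : ∀ m d r n₃ → r ≤ d → 2 N.* (suc m N.* d N.+ r) < suc (suc m) N.* d N.+ n₃ → suc (suc m) N.* r < n₃
low-exponent m d r n₃ r≤d lt = NP.+-cancelˡ-< (suc (suc m) N.* d) _ _ (NP.≤-<-trans bound lt)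
  where
  open NP.≤-Reasoning
  open NS.+-*-Solver
  bound : suc (suc m) N.* d N.+ suc (suc m) N.* r ≤ 2 N.* (suc m N.* d N.+ r)
  bound = begin
    suc (suc m) N.* d N.+ suc (suc m) N.* r
      ≡⟨ solve 3 (λ m d r → (con 2 :+ m) :* d :+ (con 2 :+ m) :* r := ((con 2 :+ m) :* d :+ con 2 :* r) :+ m :* r) ≡.refl m d r ⟩
    (suc (suc m) N.* d N.+ 2 N.* r) N.+ m N.* r
      ≤⟨ NP.+-monoʳ-≤ (suc (suc m) N.* d N.+ 2 N.* r) (NP.*-monoʳ-≤ m r≤d) ⟩
    (suc (suc m) N.* d N.+ 2 N.* r) N.+ m N.* d
      ≡⟨ solve 3 (λ m d r → ((con 2 :+ m) :* d :+ con 2 :* r) :+ m :* d := con 2 :* ((con 1 :+ m) :* d :+ r)) ≡.refl m d r ⟩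
    2 N.* (suc m N.* d N.+ r) ∎

theorem5p4 : ∀ {c ℓ : Level} (R : CommutativeRing c ℓ) →
    let open CommutativeRing R in
    let open PolyDefs R in
    IsField → CharZero →
    (n₁ n₂ n₃ : ℕ) → n₂ < n₁ → n₃ < n₂ → 0 < n₃ → 2 N.* n₂ < n₁ N.+ n₃ →
    (a₁ a₂ a₃ a₄ : Carrier) → ((a₁ * a₂) * a₃) ≉ 0# →
    (g h : Poly) →
    ((mono a₁ n₁ +ₚ mono a₂ n₂) +ₚ (mono a₃ n₃ +ₚ mono a₄ 0)) ≈ₚ (g ∘ₚ h) →
    DegreeAtLeast g 2 → DegreeAtLeast h 2 → Monic h → coeff h 0 ≈ 0# →
    Σ ℕ λ k → Σ (NonZero k) λ nz →
    (k ∣ gcd n₁ (gcd n₂ n₃)) × (h ≈ₚ mono 1# k) ×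
    (g ≈ₚ ((mono a₁ ((n₁ / k) {{nz}}) +ₚ mono a₂ ((n₂ / k) {{nz}})) +ₚ (mono a₃ ((n₃ / k) {{nz}}) +ₚ mono a₄ 0)))
-- Matching on the bound 2 ≤ deg g writes this degree as `suc (suc m)`, the form that `low-exponent`
-- requires.
theorem5p4 R fld charZero n₁ n₂ n₃ n₂<n₁ n₃<n₂ 0<n₃ 2n₂<n₁+n₃ a₁ a₂ a₃ a₄ a₁a₂a₃≉0 g h f≈
           (suc (suc m) , s≤s (s≤s _) , dg@(gm≉0 , _)) _ (d , (hd≉0 , dh) , hd) h0
    = conclusion
  where
  open CommutativeRing R hiding (zero)
  open PolyDefs R
  open Coefficients R

  -- The shape of `h`.

  f : Poly
  -- Bracketed as in the hypothesis `f≈`, so that the two agree by definition.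
  f = quadrinomial a₁ a₂ a₃ a₄ n₁ n₂ n₃

  a₁≉0 : a₁ ≉ 0#
  a₁≉0 z = a₁a₂a₃≉0 (*-zero-left (*-zero-left z))

  a₂≉0 : a₂ ≉ 0#
  a₂≉0 z = a₁a₂a₃≉0 (*-zero-left (*-zero-right z))

  a₃≉0 : a₃ ≉ 0#
  a₃≉0 z = a₁a₂a₃≉0 (*-zero-right z)

  0<d : 0 < d
  -- For d = 0 the leading coefficient of `h` would be h(0) = 0.
  0<d = NP.n≢0⇒n>0 λ { ≡.refl → hd≉0 h0 }

  instance
    d≢0 : NonZero d
    d≢0 = >-nonZero 0<d

  n₁≡md : n₁ ≡ suc (suc m) N.* d
  n₁≡md = ∘-quadrinomial-degree R n₁ n₂ n₃ n₂<n₁ n₃<n₂ 0<n₃ a₁ a₂ a₃ a₄ a₁≉0 g h (suc (suc m)) d f≈ 0<d h0 dg dh hd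

  top : ℕ
  top = suc m N.* d

  below-n₁ : ∀ r → r < d → top N.+ r < n₁
  below-n₁ r r<d = ≡.subst (top N.+ r <_) (≡.trans (NP.+-comm top d) (≡.sym n₁≡md)) (NP.+-monoʳ-< top r<d)

  -- Since n₁ = `top` + d, the polynomial `f` has no term at `top` + r for l < r < d. The value l =
  -- n₂ - `top` serves to refute `top` < n₂, and l = 0 applies once n₂ ≤ `top` is known.
  vanish-above : ∀ l → n₂ ≤ top N.+ l → ∀ i → l < i → i < d → coeff h i ≈ 0#
  vanish-above l n₂≤ = middle-coeffs-vanish fld charZero g h (suc m) d h0 dg dh hd l λ r l<r r<d →
    trans (sym (f≈ _)) (coeff-quadrinomial-between a₁ a₂ a₃ a₄ n₁ n₂ n₃ n₂<n₁ n₃<n₂ 0<n₃ (top N.+ r)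
      (NP.≤-<-trans n₂≤ (NP.+-monoʳ-< top l<r)) (below-n₁ r r<d))

  n₂≤top : n₂ ≤ top
  n₂≤top = NP.≮⇒≥ λ top<n₂ → absurd (n₂ N.∸ top) (≡.sym (NP.m+[n∸m]≡n (NP.<⇒≤ top<n₂))) (NP.m<n⇒0<n∸m top<n₂)
    where
    absurd : ∀ r → n₂ ≡ top N.+ r → 0 < r → ⊥
    absurd r n₂≡ 0<r = no-low-term R fld n₁ n₂ n₃ n₂<n₁ n₃<n₂ 0<n₃ a₁ a₂ a₃ a₄ g h f≈ h0 (suc m) r gm≉0 hr≉0
      (low-exponent m d r n₃ (NP.<⇒≤ r<d) (≡.subst₂ (λ x y → 2 N.* x < y N.+ n₃) n₂≡ n₁≡md 2n₂<n₁+n₃))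
      where
      r<d : r < d
      r<d = NP.+-cancelˡ-< top r d (≡.subst₂ _<_ n₂≡ (≡.trans n₁≡md (NP.+-comm d top)) n₂<n₁)
      hr≉0 : coeff h r ≉ 0#
      -- By `∘-second-coeff`, with its gap supplied by `vanish-above r`, `a₂` is a multiple of
      -- `coeff h r`.
      hr≉0 z = a₂≉0 (trans (sym (coeff-quadrinomial-2 a₁ a₂ a₃ a₄ n₁ n₂ n₃ n₂<n₁ n₃<n₂ 0<n₃)) (trans (f≈ n₂)
        (trans (coeff-≡ (g ∘ₚ h) n₂≡) (trans
          (∘-second-coeff g h (suc m) d r 0<r r<d h0 (proj₂ dg) dh hd (vanish-above r (NP.≤-reflexive n₂≡)))
          (*-zero-right (*-zero-right z))))))

  h≢d : ∀ i → i ≢ d → coeff h i ≈ 0#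
  h≢d zero _ = h0
  h≢d i@(suc _) i≢d with NP.<-cmp i d
  ... | tri< i<d _ _ = vanish-above 0 (≡.subst (n₂ ≤_) (≡.sym (NP.+-identityʳ top)) n₂≤top) i (s≤s z≤n) i<d
  ... | tri≈ _ i≡d _ = contradiction i≡d i≢d
  ... | tri> _ _ d<i = dh i d<i

  h≈ : h ≈ₚ mono 1# d
  h≈ i with i N.≟ d
  ... | yes ≡.refl = trans hd (sym (coeff-mono-≡ 1# d))
  ... | no i≢d = trans (h≢d i i≢d) (sym (coeff-mono-≢ 1# d i i≢d))

  -- Divisibility of the exponents and the shape of `g`.

  d∣ : ∀ n → coeff f n ≉ 0# → d ∣ n
  d∣ n fn≉0 with d ∣? n
  ... | yes d∣n = d∣n
  -- With `h` equal to x^d, g(h) has terms only at multiples of `d`.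
  ... | no d∤n = contradiction (trans (f≈ n) (∘-power-nonmultiple h d 0<d hd h≢d g n d∤n)) fn≉0

  d∣n₁ : d ∣ n₁
  d∣n₁ = d∣ n₁ λ z → a₁≉0 (trans (sym (coeff-quadrinomial-1 a₁ a₂ a₃ a₄ n₁ n₂ n₃ n₂<n₁ n₃<n₂ 0<n₃)) z)

  d∣n₂ : d ∣ n₂
  d∣n₂ = d∣ n₂ λ z → a₂≉0 (trans (sym (coeff-quadrinomial-2 a₁ a₂ a₃ a₄ n₁ n₂ n₃ n₂<n₁ n₃<n₂ 0<n₃)) z)

  d∣n₃ : d ∣ n₃
  d∣n₃ = d∣ n₃ λ z → a₃≉0 (trans (sym (coeff-quadrinomial-3 a₁ a₂ a₃ a₄ n₁ n₂ n₃ n₂<n₁ n₃<n₂ 0<n₃)) z)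

  g≈ : g ≈ₚ quadrinomial a₁ a₂ a₃ a₄ (n₁ / d) (n₂ / d) (n₃ / d)
  -- Coefficient `i` of `g` is coefficient `i * d` of g(h), hence of `f`; divisibility by `d` turns
  -- each exponent (n / d) d back into n.
  g≈ i = sym (trans (coeff-quadrinomial-*d a₁ a₂ a₃ a₄ (n₁ / d) (n₂ / d) (n₃ / d) i d)
    (trans f-at (trans (f≈ (i N.* d)) (∘-power-multiple h d 0<d hd h≢d g i))))
    where
    f-at : coeff (quadrinomial a₁ a₂ a₃ a₄ (n₁ / d N.* d) (n₂ / d N.* d) (n₃ / d N.* d)) (i N.* d) ≈ coeff f (i N.* d)
    f-at rewrite m/n*n≡m d∣n₁ | m/n*n≡m d∣n₂ | m/n*n≡m d∣n₃ = refl

  conclusion : Σ ℕ λ k → Σ (NonZero k) λ nz →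
    (k ∣ gcd n₁ (gcd n₂ n₃)) × (h ≈ₚ mono 1# k) ×
    (g ≈ₚ quadrinomial a₁ a₂ a₃ a₄ ((n₁ / k) {{nz}}) ((n₂ / k) {{nz}}) ((n₃ / k) {{nz}}))
  conclusion = d , d≢0 , gcd-greatest d∣n₁ (gcd-greatest d∣n₂ d∣n₃) , h≈ , g≈
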